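{- If $n$ is a non-negative integer and $t$ is any integer, then $$\sum_{k=1}^n(-4)^{k}\frac{k}{n+k}\binom{n+k}{n-k}L_{k+t}=\begin{cases}-\frac12L_{t+1}L_{3n},& n\text{ odd};\\ \frac52F_{t+1}F_{3n},& n\text{ even};\end{cases}$$ $$\sum_{k=1}^n(-4)^{k}\frac{k}{n+k}\binom{n+k}{n-k}F_{k+t}=\begin{cases}-\frac12F_{t+1}L_{3n},& n\text{ odd};\\ \frac12L_{t+1}F_{3n},& n\text{ even}.\end{cases}$$
   Context: $F_n$ and $L_n$ ($n\in\mathbb{Z}$) are the Fibonacci and Lucas numbers: $F_0=0$, $F_1=1$, $F_n=F_{n-1}+F_{n-2}$; $L_0=2$, $L_1=1$, $L_n=L_{n-1}+L_{n-2}$, extended to negative indices by $F_{ -n}=(-1)^{n-1}F_n$, $L_{ -n}=(-1)^nL_n$. An empty sum is $0$. -}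

module Defs where

open import Data.Integer.Base as ℤ using (ℤ; +_; -[1+_]; -1ℤ)
open import Data.Nat.Base as ℕ using (ℕ; zero; suc; NonZero)
open import Data.Nat.Combinatorics using (_C_)
open import Data.Rational.Base using (ℚ; 0ℚ; _+_; _*_; _/_)

fib : ℕ → ℕ
fib zero          = 0
fib (suc zero)    = 1
fib (suc (suc n)) = fib (suc n) ℕ.+ fib n

lucas : ℕ → ℕ
lucas zero          = 2
lucas (suc zero)    = 1
lucas (suc (suc n)) = lucas (suc n) ℕ.+ lucas n

-- Since -[1+ m ] is -(m + 1), the rules F₋ₙ = (-1)ⁿ⁻¹Fₙ and L₋ₙ = (-1)ⁿLₙ
-- are used with n = m + 1.
F : ℤ → ℤ
F (+ n)    = + fib n
F -[1+ m ] = (-1ℤ ℤ.^ m) ℤ.* (+ fib (suc m))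

L : ℤ → ℤ
L (+ n)    = + lucas n
L -[1+ m ] = (-1ℤ ℤ.^ suc m) ℤ.* (+ lucas (suc m))

fromℤ : ℤ → ℚ
fromℤ z = z / 1

-- ∑[1≤ k ≤ n ] f k = f 1 + ⋯ + f n.  The summand may use that k is nonzero,
-- so that it may divide by n + k.
sumFrom1 : (n : ℕ) → ((k : ℕ) → .{{NonZero k}} → ℚ) → ℚ
sumFrom1 zero    f = 0ℚ
sumFrom1 (suc n) f = sumFrom1 n f + f (suc n)

infix 5 sumFrom1
syntax sumFrom1 n (λ k → e) = ∑[1≤ k ≤ n ] e

-- (-4)ᵏ · k/(n+k) · C(n+k, n-k), meant for 1 ≤ k ≤ n, where n ∸ k is the true
-- difference.
weight : (n k : ℕ) → .{{NonZero k}} → ℚ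
weight n k = fromℤ ((ℤ.- (+ 4)) ℤ.^ k)
           * _/_ (+ k) (n ℕ.+ k) {{n+k≢0 n k}}
           * fromℤ (+ ((n ℕ.+ k) C (n ℕ.∸ k)))
  where
  n+k≢0 : ∀ n k → .{{NonZero k}} → NonZero (n ℕ.+ k)
  n+k≢0 zero    (suc k) = _
  n+k≢0 (suc n) k       = _

{-# OPTIONS --safe #-}
module Submission where

-- Since k/(n+k) C(n+k, n-k) = ½ C(n+k-1, 2k-1), the sum is half of
-- P(n) = Σ C(n+j, 2j+1) f(j+1) with f(j) = (-4)ʲ G(j+t) and G = F or L.  Together
-- with Q(n) = Σ C(n+j, 2j) f(j), Pascal's rule gives
--   P(n+1)[f] = P(n)[f] + Q(n)[f ∘ suc],   Q(n+1)[f] = Q(n)[f] + P(n+1)[f].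
-- As f satisfies a second-order recurrence, P(n) and Q(n) are linear in f(0), f(1),
-- and an induction on n identifies their coefficients in terms of F₃ₙ and L₃ₙ,
-- which evolve by F₃ₙ₊₃ = 2F₃ₙ + L₃ₙ and L₃ₙ₊₃ = 5F₃ₙ + 2L₃ₙ.

open import Defs
open import Data.Integer.Base as ℤ using (ℤ; +_; -[1+_]; 0ℤ; 1ℤ; -1ℤ)
import Data.Integer.Properties as ℤ
open import Data.Integer.Tactic.RingSolver using (solve-∀)
open import Data.Nat.Base as ℕ using (ℕ; zero; suc; parity; _≤_; NonZero)
open import Data.Nat.Combinatorics
  using (_C_; nC1≡n; nCk≡nC[n∸k]; k>n⇒nCk≡0; nCk+nC[k+1]≡[n+1]C[k+1])
import Data.Nat.Properties as ℕ
import Data.Nat.Tactic.RingSolver as ℕ-Ring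
open import Data.Parity.Base using (Parity; 0ℙ; 1ℙ; _⁻¹)
open import Data.Parity.Properties using (suc-homo-⁻¹; ⁻¹-selfInverse)
open import Data.Product.Base using (_×_; _,_; proj₁; proj₂)
open import Data.Rational.Base using (ℚ; _+_; _*_; _/_; ½; -½; fromℚᵘ)
import Data.Rational.Properties as ℚ
open import Data.Rational.Unnormalised.Base as ℚᵘ using (ℚᵘ; mkℚᵘ; *≡*)
import Data.Rational.Unnormalised.Properties as ℚᵘ
open import Function.Base using (_∘_)
open import Relation.Binary.PropositionalEquality
  using (_≡_; refl; sym; trans; cong; cong₂; subst; module ≡-Reasoning)

open ≡-Reasoning

-- Binomial coefficients

-- The absorption identity, which later turns the factor k/(n+k) into ½. Pascal's rule splits the
-- left side, and the induction hypothesis is applied at both `k` and `suc k`.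
[1+k]*[1+n]C[1+k]≡[1+n]*nCk : ∀ n k → suc k ℕ.* (suc n C suc k) ≡ suc n ℕ.* (n C k)
[1+k]*[1+n]C[1+k]≡[1+n]*nCk n zero = begin
  1 ℕ.* (suc n C 1)  ≡⟨ ℕ.*-identityˡ (suc n C 1) ⟩
  suc n C 1          ≡⟨ nC1≡n (suc n) ⟩
  suc n              ≡⟨ ℕ.*-identityʳ (suc n) ⟨
  suc n ℕ.* (n C 0)  ∎
[1+k]*[1+n]C[1+k]≡[1+n]*nCk zero (suc k) = ℕ.*-zeroʳ (suc (suc k))
[1+k]*[1+n]C[1+k]≡[1+n]*nCk (suc n) (suc k) = begin
  suc (suc k) ℕ.* (suc (suc n) C suc (suc k))
    ≡⟨ cong (suc (suc k) ℕ.*_) (nCk+nC[k+1]≡[n+1]C[k+1] (suc n) (suc k)) ⟨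
  suc (suc k) ℕ.* (c ℕ.+ (suc n C suc (suc k)))
    ≡⟨ ℕ.*-distribˡ-+ (suc (suc k)) c (suc n C suc (suc k)) ⟩
  (c ℕ.+ suc k ℕ.* c) ℕ.+ suc (suc k) ℕ.* (suc n C suc (suc k))
    ≡⟨ cong₂ (λ x y → (c ℕ.+ x) ℕ.+ y)
         ([1+k]*[1+n]C[1+k]≡[1+n]*nCk n k) ([1+k]*[1+n]C[1+k]≡[1+n]*nCk n (suc k)) ⟩
  (c ℕ.+ suc n ℕ.* (n C k)) ℕ.+ suc n ℕ.* (n C suc k)
    ≡⟨ ℕ.+-assoc c (suc n ℕ.* (n C k)) (suc n ℕ.* (n C suc k)) ⟩
  c ℕ.+ (suc n ℕ.* (n C k) ℕ.+ suc n ℕ.* (n C suc k))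
    ≡⟨ cong (c ℕ.+_) (ℕ.*-distribˡ-+ (suc n) (n C k) (n C suc k)) ⟨
  c ℕ.+ suc n ℕ.* ((n C k) ℕ.+ (n C suc k))
    ≡⟨ cong (λ x → c ℕ.+ suc n ℕ.* x) (nCk+nC[k+1]≡[n+1]C[k+1] n k) ⟩
  c ℕ.+ suc n ℕ.* c  ∎
  where c = suc n C suc k

-- Sums

sum< : ℕ → (ℕ → ℤ) → ℤ
sum< zero    f = 0ℤ
sum< (suc n) f = sum< n f ℤ.+ f n

sum<-cong : ∀ n {f g} → (∀ j → f j ≡ g j) → sum< n f ≡ sum< n g
sum<-cong zero    f≗g = refl
sum<-cong (suc n) f≗g = cong₂ ℤ._+_ (sum<-cong n f≗g) (f≗g n)

sum<-+ : ∀ n f g → sum< n (λ j → f j ℤ.+ g j) ≡ sum< n f ℤ.+ sum< n g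
sum<-+ zero    f g = refl
sum<-+ (suc n) f g = trans (cong (ℤ._+ (f n ℤ.+ g n)) (sum<-+ n f g))
  (interchange (sum< n f) (sum< n g) (f n) (g n))
  where
  interchange : ∀ a b c d → (a ℤ.+ b) ℤ.+ (c ℤ.+ d) ≡ (a ℤ.+ c) ℤ.+ (b ℤ.+ d)
  interchange = solve-∀

sum<-head : ∀ n f → sum< (suc n) f ≡ f 0 ℤ.+ sum< n (f ∘ suc)
sum<-head zero    f = ℤ.+-comm 0ℤ (f 0)
sum<-head (suc n) f = trans (cong (ℤ._+ f (suc n)) (sum<-head n f))
  (ℤ.+-assoc (f 0) (sum< n (f ∘ suc)) (f (suc n)))

-- P and Q of the overview. The ranges stop exactly where the binomials start to vanish: j < n for
-- the odd lower index, j ≤ n for the even one.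
oddSum evenSum : (ℕ → ℤ) → ℕ → ℤ
oddSum  f n = sum< n       (λ j → + ((n ℕ.+ j) C suc (j ℕ.+ j)) ℤ.* f (suc j))
evenSum f n = sum< (suc n) (λ j → + ((n ℕ.+ j) C (j ℕ.+ j)) ℤ.* f j)

-- Pascal recurrences for the two sums

vanish : ∀ {n k} x → n ℕ.< k → + (n C k) ℤ.* x ≡ 0ℤ
vanish x n<k = cong (λ c → + c ℤ.* x) (k>n⇒nCk≡0 n<k)

pascal : ∀ n k x → + (suc n C suc k) ℤ.* x ≡ + (n C suc k) ℤ.* x ℤ.+ + (n C k) ℤ.* x
pascal n k x = begin
  + (suc n C suc k) ℤ.* x
    ≡⟨ cong (λ c → + c ℤ.* x) (nCk+nC[k+1]≡[n+1]C[k+1] n k) ⟨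
  (+ (n C k) ℤ.+ + (n C suc k)) ℤ.* x
    ≡⟨ ℤ.*-distribʳ-+ x (+ (n C k)) (+ (n C suc k)) ⟩
  + (n C k) ℤ.* x ℤ.+ + (n C suc k) ℤ.* x
    ≡⟨ ℤ.+-comm (+ (n C k) ℤ.* x) (+ (n C suc k) ℤ.* x) ⟩
  + (n C suc k) ℤ.* x ℤ.+ + (n C k) ℤ.* x  ∎

oddSum-suc : ∀ f n → oddSum f (suc n) ≡ oddSum f n ℤ.+ evenSum (f ∘ suc) n
oddSum-suc f n = begin
  oddSum f (suc n)
    ≡⟨ sum<-cong (suc n) (λ j → pascal (n ℕ.+ j) (j ℕ.+ j) (f (suc j))) ⟩
  sum< (suc n) (λ j → a j ℤ.+ + ((n ℕ.+ j) C (j ℕ.+ j)) ℤ.* f (suc j))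
    ≡⟨ sum<-+ (suc n) a _ ⟩
  (oddSum f n ℤ.+ a n) ℤ.+ evenSum (f ∘ suc) n
    -- The sum runs one index beyond `oddSum f n`; the extra term j = n carries C(2n, 2n+1) = 0.
    ≡⟨ cong (λ x → (oddSum f n ℤ.+ x) ℤ.+ evenSum (f ∘ suc) n) (vanish {n ℕ.+ n} (f (suc n)) ℕ.≤-refl) ⟩
  (oddSum f n ℤ.+ 0ℤ) ℤ.+ evenSum (f ∘ suc) n
    ≡⟨ cong (ℤ._+ evenSum (f ∘ suc) n) (ℤ.+-identityʳ (oddSum f n)) ⟩
  oddSum f n ℤ.+ evenSum (f ∘ suc) n  ∎
  where
  a : ℕ → ℤ
  a j = + ((n ℕ.+ j) C suc (j ℕ.+ j)) ℤ.* f (suc j)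

evenSum-suc : ∀ f n → evenSum f (suc n) ≡ evenSum f n ℤ.+ oddSum f (suc n)
evenSum-suc f n = begin
  evenSum f (suc n)
    -- Pascal's rule needs a positive lower index, so the term j = 0 is split off. It is already
    -- `a 0`, as binomials with lower index 0 compute to 1.
    ≡⟨ sum<-head (suc n) _ ⟩
  a 0 ℤ.+ sum< (suc n) (λ j → + ((suc n ℕ.+ suc j) C (suc j ℕ.+ suc j)) ℤ.* f (suc j))
    ≡⟨ cong (ℤ._+_ (a 0)) (sum<-cong (suc n) split) ⟩
  a 0 ℤ.+ sum< (suc n) (λ j → a (suc j) ℤ.+ b j)
    ≡⟨ cong (ℤ._+_ (a 0)) (sum<-+ (suc n) (a ∘ suc) b) ⟩
  a 0 ℤ.+ (sum< (suc n) (a ∘ suc) ℤ.+ oddSum f (suc n))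
    ≡⟨ ℤ.+-assoc (a 0) (sum< (suc n) (a ∘ suc)) (oddSum f (suc n)) ⟨
  (a 0 ℤ.+ sum< (suc n) (a ∘ suc)) ℤ.+ oddSum f (suc n)
    ≡⟨ cong (ℤ._+ oddSum f (suc n)) (sum<-head (suc n) a) ⟨
  (evenSum f n ℤ.+ a (suc n)) ℤ.+ oddSum f (suc n)
    -- The extra term j = n+1 carries C(2n+1, 2n+2) = 0.
    ≡⟨ cong (λ x → (evenSum f n ℤ.+ x) ℤ.+ oddSum f (suc n))
         (vanish (f (suc n)) (ℕ.n<1+n (n ℕ.+ suc n))) ⟩
  (evenSum f n ℤ.+ 0ℤ) ℤ.+ oddSum f (suc n)
    ≡⟨ cong (ℤ._+ oddSum f (suc n)) (ℤ.+-identityʳ (evenSum f n)) ⟩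
  evenSum f n ℤ.+ oddSum f (suc n)  ∎
  where
  a b : ℕ → ℤ
  a j = + ((n ℕ.+ j) C (j ℕ.+ j)) ℤ.* f j
  b j = + ((suc n ℕ.+ j) C suc (j ℕ.+ j)) ℤ.* f (suc j)
  split : ∀ j → + ((suc n ℕ.+ suc j) C (suc j ℕ.+ suc j)) ℤ.* f (suc j) ≡ a (suc j) ℤ.+ b j
  split j = trans (pascal (n ℕ.+ suc j) (j ℕ.+ suc j) (f (suc j)))
    (cong (ℤ._+_ (a (suc j))) (cong₂ (λ m k → + (m C k) ℤ.* f (suc j)) (ℕ.+-suc n j) (ℕ.+-suc j j)))

-- Fibonacci and Lucas numbers

-- Both sides satisfy the Fibonacci recurrence and agree at 0 and 1. The additive form keeps the
-- induction in ℕ, free of subtraction.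
lucas+fib : ∀ n → lucas n ℕ.+ fib n ≡ 2 ℕ.* fib (suc n)
lucas+fib zero          = refl
lucas+fib (suc zero)    = refl
lucas+fib (suc (suc n)) = begin
  (lucas (suc n) ℕ.+ lucas n) ℕ.+ (fib (suc n) ℕ.+ fib n)
    ≡⟨ interchange (lucas (suc n)) (lucas n) (fib (suc n)) (fib n) ⟩
  (lucas (suc n) ℕ.+ fib (suc n)) ℕ.+ (lucas n ℕ.+ fib n)
    ≡⟨ cong₂ ℕ._+_ (lucas+fib (suc n)) (lucas+fib n) ⟩
  2 ℕ.* fib (suc (suc n)) ℕ.+ 2 ℕ.* fib (suc n)
    ≡⟨ ℕ.*-distribˡ-+ 2 (fib (suc (suc n))) (fib (suc n)) ⟨
  2 ℕ.* fib (suc (suc (suc n)))  ∎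
  where
  interchange : ∀ a b c d → (a ℕ.+ b) ℕ.+ (c ℕ.+ d) ≡ (a ℕ.+ c) ℕ.+ (b ℕ.+ d)
  interchange = ℕ-Ring.solve-∀

lucas-fib : ∀ n → + lucas n ≡ + 2 ℤ.* + fib (suc n) ℤ.- + fib n
lucas-fib n = begin
  + lucas n
    ≡⟨ cancel (+ lucas n) (+ fib n) ⟩
  + (lucas n ℕ.+ fib n) ℤ.- + fib n
    ≡⟨ cong (λ x → + x ℤ.- + fib n) (lucas+fib n) ⟩
  + (2 ℕ.* fib (suc n)) ℤ.- + fib n
    ≡⟨ cong (ℤ._- + fib n) (ℤ.pos-* 2 (fib (suc n))) ⟩
  + 2 ℤ.* + fib (suc n) ℤ.- + fib n  ∎
  where
  cancel : ∀ x y → x ≡ (x ℤ.+ y) ℤ.- y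
  cancel = solve-∀

fib-3+ : ∀ n → + fib (3 ℕ.+ n) ≡ + 2 ℤ.* + fib n ℤ.+ + lucas n
fib-3+ n = begin
  + fib (3 ℕ.+ n)
    ≡⟨ identity (+ fib (suc n)) (+ fib n) ⟩
  + 2 ℤ.* + fib n ℤ.+ (+ 2 ℤ.* + fib (suc n) ℤ.- + fib n)
    ≡⟨ cong (ℤ._+_ (+ 2 ℤ.* + fib n)) (lucas-fib n) ⟨
  + 2 ℤ.* + fib n ℤ.+ + lucas n  ∎
  where
  identity : ∀ x y → ((x ℤ.+ y) ℤ.+ x) ≡ + 2 ℤ.* y ℤ.+ (+ 2 ℤ.* x ℤ.- y)
  identity = solve-∀

lucas-3+ : ∀ n → + lucas (3 ℕ.+ n) ≡ + 5 ℤ.* + fib n ℤ.+ + 2 ℤ.* + lucas n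
lucas-3+ n = begin
  + lucas (3 ℕ.+ n)
    ≡⟨ lucas-fib (3 ℕ.+ n) ⟩
  + 2 ℤ.* + fib (4 ℕ.+ n) ℤ.- + fib (3 ℕ.+ n)
    ≡⟨ identity (+ fib (suc n)) (+ fib n) ⟩
  + 5 ℤ.* + fib n ℤ.+ + 2 ℤ.* (+ 2 ℤ.* + fib (suc n) ℤ.- + fib n)
    ≡⟨ cong (λ x → + 5 ℤ.* + fib n ℤ.+ + 2 ℤ.* x) (lucas-fib n) ⟨
  + 5 ℤ.* + fib n ℤ.+ + 2 ℤ.* + lucas n  ∎
  where
  identity : ∀ x y → + 2 ℤ.* (((x ℤ.+ y) ℤ.+ x) ℤ.+ (x ℤ.+ y)) ℤ.- ((x ℤ.+ y) ℤ.+ x)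
                     ≡ + 5 ℤ.* y ℤ.+ + 2 ℤ.* (+ 2 ℤ.* x ℤ.- y)
  identity = solve-∀

Additive : (ℤ → ℤ) → Set
Additive G = ∀ z → G (ℤ.suc (ℤ.suc z)) ≡ G (ℤ.suc z) ℤ.+ G z

-- H(z) = G(z+1) + G(z-1), so that L is the companion of F and 5F that of L.
Companion : (G H : ℤ → ℤ) → Set
Companion G H = ∀ z → H z ≡ + 2 ℤ.* G (ℤ.suc z) ℤ.- G z

-- The recurrence at negative indices: `s` is the sign at the largest of the three indices, `x` and
-- `y` are consecutive values at positive indices, and the alternating signs cancel `y`.
negative-step : ∀ s x y → s ℤ.* x ≡ (-1ℤ ℤ.* s) ℤ.* y ℤ.+ (-1ℤ ℤ.* (-1ℤ ℤ.* s)) ℤ.* (y ℤ.+ x)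
negative-step = solve-∀

F-additive : Additive F
F-additive (+ n)             = refl
-- At z = -1 and z = -2 the three indices reach 0 or 1, outside the negative branch of `F`, so these
-- cases are computed.
F-additive -[1+ 0 ]          = refl
F-additive -[1+ 1 ]          = refl
F-additive -[1+ suc (suc m)] = negative-step (-1ℤ ℤ.^ m) (+ fib (suc m)) (+ fib (suc (suc m)))

L-additive : Additive L
L-additive (+ n)             = refl
L-additive -[1+ 0 ]          = refl
L-additive -[1+ 1 ]          = refl
L-additive -[1+ suc (suc m)] =
  negative-step (-1ℤ ℤ.^ suc m) (+ lucas (suc m)) (+ lucas (suc (suc m)))

F-companion : Companion F L
F-companion (+ n)        = lucas-fib n
F-companion -[1+ 0 ]     = refl
F-companion -[1+ suc m ] = begin
  (-1ℤ ℤ.* (-1ℤ ℤ.* s)) ℤ.* + lucas (suc (suc m))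
    ≡⟨ cong ((-1ℤ ℤ.* (-1ℤ ℤ.* s)) ℤ.*_) (lucas-fib (suc (suc m))) ⟩
  (-1ℤ ℤ.* (-1ℤ ℤ.* s)) ℤ.* (+ 2 ℤ.* + fib (3 ℕ.+ m) ℤ.- + fib (2 ℕ.+ m))
    ≡⟨ identity s (+ fib (2 ℕ.+ m)) (+ fib (suc m)) ⟩
  + 2 ℤ.* (s ℤ.* + fib (suc m)) ℤ.- (-1ℤ ℤ.* s) ℤ.* + fib (2 ℕ.+ m)  ∎
  where
  s = -1ℤ ℤ.^ m
  identity : ∀ s x y → (-1ℤ ℤ.* (-1ℤ ℤ.* s)) ℤ.* (+ 2 ℤ.* (x ℤ.+ y) ℤ.- x)
                       ≡ + 2 ℤ.* (s ℤ.* y) ℤ.- (-1ℤ ℤ.* s) ℤ.* x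
  identity = solve-∀

-- On additive sequences the shift E satisfies E² = E + 1, so (2E - 1)² = 4E² - 4E + 1 = 5: taking
-- the companion twice multiplies by 5.
L-companion : Companion L (λ z → + 5 ℤ.* F z)
L-companion z = begin
  + 5 ℤ.* F z
    ≡⟨ identity (F (ℤ.suc z)) (F z) ⟩
  + 2 ℤ.* (+ 2 ℤ.* (F (ℤ.suc z) ℤ.+ F z) ℤ.- F (ℤ.suc z)) ℤ.- (+ 2 ℤ.* F (ℤ.suc z) ℤ.- F z)
    ≡⟨ cong (λ x → + 2 ℤ.* (+ 2 ℤ.* x ℤ.- F (ℤ.suc z)) ℤ.- (+ 2 ℤ.* F (ℤ.suc z) ℤ.- F z))
         (F-additive z) ⟨
  + 2 ℤ.* (+ 2 ℤ.* F (ℤ.suc (ℤ.suc z)) ℤ.- F (ℤ.suc z)) ℤ.- (+ 2 ℤ.* F (ℤ.suc z) ℤ.- F z)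
    ≡⟨ cong₂ (λ x y → + 2 ℤ.* x ℤ.- y) (F-companion (ℤ.suc z)) (F-companion z) ⟨
  + 2 ℤ.* L (ℤ.suc z) ℤ.- L z  ∎
  where
  identity : ∀ x y → + 5 ℤ.* y
    ≡ + 2 ℤ.* (+ 2 ℤ.* (x ℤ.+ y) ℤ.- x) ℤ.- (+ 2 ℤ.* x ℤ.- y)
  identity = solve-∀

-- The closed forms

-- The roots of the recurrence are -4 times those of G(n+2) = G(n+1) + G(n).
Recurrent : (ℕ → ℤ) → Set
Recurrent f = ∀ j → f (suc (suc j)) ≡ + 16 ℤ.* f j ℤ.- + 4 ℤ.* f (suc j)

-- Eight times oddSum f n and evenSum f n, with a = f 0, b = f 1, u = F₃ₙ, v = L₃ₙ.
oddValue evenValue : Parity → (a b u v : ℤ) → ℤ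
oddValue  0ℙ a b u v = + 2 ℤ.* ((+ 8 ℤ.* a ℤ.- b) ℤ.* u)
oddValue  1ℙ a b u v = + 2 ℤ.* (b ℤ.* v)
evenValue 0ℙ a b u v = + 4 ℤ.* a ℤ.* v ℤ.+ (+ 8 ℤ.* a ℤ.- b) ℤ.* u
evenValue 1ℙ a b u v = b ℤ.* v ℤ.+ (+ 2 ℤ.* b ℤ.+ + 4 ℤ.* a) ℤ.* u

-- The shifted sequence starts with b and 16a - 4b, while u and v advance by three indices. Let φ >
-- ψ be the roots of x² = x + 1. On f(j) = (-4φ)ʲ the pair (P, Q) evolves with multipliers -φ³ and
-- ψ³, on (-4ψ)ʲ with φ³ and -ψ³; hence the tripled index and the dependence on parity.
oddValue-step : ∀ p a b u v →
  oddValue p a b u v ℤ.+ evenValue p b (+ 16 ℤ.* a ℤ.- + 4 ℤ.* b) u v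
    ≡ oddValue (p ⁻¹) a b (+ 2 ℤ.* u ℤ.+ v) (+ 5 ℤ.* u ℤ.+ + 2 ℤ.* v)
oddValue-step 0ℙ = identity
  where
  identity : ∀ a b u v →
    + 2 ℤ.* ((+ 8 ℤ.* a ℤ.- b) ℤ.* u)
      ℤ.+ (+ 4 ℤ.* b ℤ.* v ℤ.+ (+ 8 ℤ.* b ℤ.- (+ 16 ℤ.* a ℤ.- + 4 ℤ.* b)) ℤ.* u)
      ≡ + 2 ℤ.* (b ℤ.* (+ 5 ℤ.* u ℤ.+ + 2 ℤ.* v))
  identity = solve-∀
oddValue-step 1ℙ = identity
  where
  identity : ∀ a b u v →
    + 2 ℤ.* (b ℤ.* v)
      ℤ.+ ((+ 16 ℤ.* a ℤ.- + 4 ℤ.* b) ℤ.* v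
           ℤ.+ (+ 2 ℤ.* (+ 16 ℤ.* a ℤ.- + 4 ℤ.* b) ℤ.+ + 4 ℤ.* b) ℤ.* u)
      ≡ + 2 ℤ.* ((+ 8 ℤ.* a ℤ.- b) ℤ.* (+ 2 ℤ.* u ℤ.+ v))
  identity = solve-∀

evenValue-step : ∀ p a b u v →
  evenValue p a b u v ℤ.+ oddValue (p ⁻¹) a b (+ 2 ℤ.* u ℤ.+ v) (+ 5 ℤ.* u ℤ.+ + 2 ℤ.* v)
    ≡ evenValue (p ⁻¹) a b (+ 2 ℤ.* u ℤ.+ v) (+ 5 ℤ.* u ℤ.+ + 2 ℤ.* v)
evenValue-step 0ℙ = identity
  where
  identity : ∀ a b u v →
    + 4 ℤ.* a ℤ.* v ℤ.+ (+ 8 ℤ.* a ℤ.- b) ℤ.* u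
      ℤ.+ + 2 ℤ.* (b ℤ.* (+ 5 ℤ.* u ℤ.+ + 2 ℤ.* v))
      ≡ b ℤ.* (+ 5 ℤ.* u ℤ.+ + 2 ℤ.* v)
        ℤ.+ (+ 2 ℤ.* b ℤ.+ + 4 ℤ.* a) ℤ.* (+ 2 ℤ.* u ℤ.+ v)
  identity = solve-∀
evenValue-step 1ℙ = identity
  where
  identity : ∀ a b u v →
    b ℤ.* v ℤ.+ (+ 2 ℤ.* b ℤ.+ + 4 ℤ.* a) ℤ.* u
      ℤ.+ + 2 ℤ.* ((+ 8 ℤ.* a ℤ.- b) ℤ.* (+ 2 ℤ.* u ℤ.+ v))
      ≡ + 4 ℤ.* a ℤ.* (+ 5 ℤ.* u ℤ.+ + 2 ℤ.* v)
        ℤ.+ (+ 8 ℤ.* a ℤ.- b) ℤ.* (+ 2 ℤ.* u ℤ.+ v)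
  identity = solve-∀

-- The sequence `f` is quantified inside because the step to n + 1 uses the hypothesis for both `f`
-- and `f ∘ suc`. The factor 8 keeps all coefficients integral.
ClosedForms : Parity → ℕ → Set
ClosedForms p n = ∀ f → Recurrent f →
    + 8 ℤ.* oddSum  f n ≡ oddValue  p (f 0) (f 1) (+ fib (3 ℕ.* n)) (+ lucas (3 ℕ.* n))
  × + 8 ℤ.* evenSum f n ≡ evenValue p (f 0) (f 1) (+ fib (3 ℕ.* n)) (+ lucas (3 ℕ.* n))

closedForms-zero : ClosedForms 0ℙ 0
closedForms-zero f _ = identity₁ (f 0) (f 1) , identity₂ (f 0) (f 1)
  where
  identity₁ : ∀ a b → 0ℤ ≡ + 2 ℤ.* ((+ 8 ℤ.* a ℤ.- b) ℤ.* 0ℤ)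
  identity₁ = solve-∀
  identity₂ : ∀ a b → + 8 ℤ.* (0ℤ ℤ.+ 1ℤ ℤ.* a) ≡ + 4 ℤ.* a ℤ.* + 2 ℤ.+ (+ 8 ℤ.* a ℤ.- b) ℤ.* 0ℤ
  identity₂ = solve-∀

closedForms-suc : ∀ p n → ClosedForms p n → ClosedForms (p ⁻¹) (suc n)
closedForms-suc p n closed f rec = odd , even
  where
  u v u′ v′ : ℤ
  u  = + fib (3 ℕ.* n)
  v  = + lucas (3 ℕ.* n)
  u′ = + fib (3 ℕ.* suc n)
  v′ = + lucas (3 ℕ.* suc n)

  u′≡ : u′ ≡ + 2 ℤ.* u ℤ.+ v
  u′≡ = trans (cong (λ m → + fib m) (ℕ.*-suc 3 n)) (fib-3+ (3 ℕ.* n))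

  v′≡ : v′ ≡ + 5 ℤ.* u ℤ.+ + 2 ℤ.* v
  v′≡ = trans (cong (λ m → + lucas m) (ℕ.*-suc 3 n)) (lucas-3+ (3 ℕ.* n))

  odd : + 8 ℤ.* oddSum f (suc n) ≡ oddValue (p ⁻¹) (f 0) (f 1) u′ v′
  odd = begin
    + 8 ℤ.* oddSum f (suc n)
      ≡⟨ cong (+ 8 ℤ.*_) (oddSum-suc f n) ⟩
    + 8 ℤ.* (oddSum f n ℤ.+ evenSum (f ∘ suc) n)
      ≡⟨ ℤ.*-distribˡ-+ (+ 8) (oddSum f n) (evenSum (f ∘ suc) n) ⟩
    + 8 ℤ.* oddSum f n ℤ.+ + 8 ℤ.* evenSum (f ∘ suc) n
      ≡⟨ cong₂ ℤ._+_ (proj₁ (closed f rec)) (proj₂ (closed (f ∘ suc) (rec ∘ suc))) ⟩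
    oddValue p (f 0) (f 1) u v ℤ.+ evenValue p (f 1) (f 2) u v
      ≡⟨ cong (λ x → oddValue p (f 0) (f 1) u v ℤ.+ evenValue p (f 1) x u v) (rec 0) ⟩
    oddValue p (f 0) (f 1) u v ℤ.+ evenValue p (f 1) (+ 16 ℤ.* f 0 ℤ.- + 4 ℤ.* f 1) u v
      ≡⟨ oddValue-step p (f 0) (f 1) u v ⟩
    oddValue (p ⁻¹) (f 0) (f 1) (+ 2 ℤ.* u ℤ.+ v) (+ 5 ℤ.* u ℤ.+ + 2 ℤ.* v)
      ≡⟨ cong₂ (oddValue (p ⁻¹) (f 0) (f 1)) u′≡ v′≡ ⟨
    oddValue (p ⁻¹) (f 0) (f 1) u′ v′  ∎

  even : + 8 ℤ.* evenSum f (suc n) ≡ evenValue (p ⁻¹) (f 0) (f 1) u′ v′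
  even = begin
    + 8 ℤ.* evenSum f (suc n)
      ≡⟨ cong (+ 8 ℤ.*_) (evenSum-suc f n) ⟩
    + 8 ℤ.* (evenSum f n ℤ.+ oddSum f (suc n))
      ≡⟨ ℤ.*-distribˡ-+ (+ 8) (evenSum f n) (oddSum f (suc n)) ⟩
    + 8 ℤ.* evenSum f n ℤ.+ + 8 ℤ.* oddSum f (suc n)
      ≡⟨ cong₂ ℤ._+_ (proj₂ (closed f rec)) odd ⟩
    evenValue p (f 0) (f 1) u v ℤ.+ oddValue (p ⁻¹) (f 0) (f 1) u′ v′
      ≡⟨ cong₂ (λ x y → evenValue p (f 0) (f 1) u v ℤ.+ oddValue (p ⁻¹) (f 0) (f 1) x y) u′≡ v′≡ ⟩
    evenValue p (f 0) (f 1) u v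
      ℤ.+ oddValue (p ⁻¹) (f 0) (f 1) (+ 2 ℤ.* u ℤ.+ v) (+ 5 ℤ.* u ℤ.+ + 2 ℤ.* v)
      ≡⟨ evenValue-step p (f 0) (f 1) u v ⟩
    evenValue (p ⁻¹) (f 0) (f 1) (+ 2 ℤ.* u ℤ.+ v) (+ 5 ℤ.* u ℤ.+ + 2 ℤ.* v)
      ≡⟨ cong₂ (evenValue (p ⁻¹) (f 0) (f 1)) u′≡ v′≡ ⟨
    evenValue (p ⁻¹) (f 0) (f 1) u′ v′  ∎

closedForms : ∀ n → ClosedForms (parity n) n
closedForms zero    = closedForms-zero
closedForms (suc n) = subst (λ p → ClosedForms p (suc n))
  -- `parity` recurses by two, so `parity n ⁻¹` and `parity (suc n)` agree only propositionally.
  (⁻¹-selfInverse (suc-homo-⁻¹ n)) (closedForms-suc (parity n) n (closedForms n))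

-- Specialisation to the sequence (-4)ʲ G(j + t)

module _ (G : ℤ → ℤ) (G-additive : Additive G) (t : ℤ) where

  scaled : ℕ → ℤ
  scaled j = (ℤ.- + 4) ℤ.^ j ℤ.* G (+ j ℤ.+ t)

  -- The recurrence of `G` at j + t, multiplied by (-4)ʲ⁺² = 16 (-4)ʲ = -4 (-4)ʲ⁺¹.
  scaled-recurrent : Recurrent scaled
  scaled-recurrent j = begin
    x ℤ.* (x ℤ.* s) ℤ.* G (+ suc (suc j) ℤ.+ t)
      ≡⟨ cong (λ z → x ℤ.* (x ℤ.* s) ℤ.* G z)
           (trans (ℤ.suc-+ (suc j) t) (cong ℤ.suc (ℤ.suc-+ j t))) ⟩
    x ℤ.* (x ℤ.* s) ℤ.* G (ℤ.suc (ℤ.suc (+ j ℤ.+ t)))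
      ≡⟨ cong (x ℤ.* (x ℤ.* s) ℤ.*_) (G-additive (+ j ℤ.+ t)) ⟩
    x ℤ.* (x ℤ.* s) ℤ.* (G (ℤ.suc (+ j ℤ.+ t)) ℤ.+ G (+ j ℤ.+ t))
      ≡⟨ identity s (G (ℤ.suc (+ j ℤ.+ t))) (G (+ j ℤ.+ t)) ⟩
    + 16 ℤ.* (s ℤ.* G (+ j ℤ.+ t)) ℤ.- + 4 ℤ.* (x ℤ.* s ℤ.* G (ℤ.suc (+ j ℤ.+ t)))
      ≡⟨ cong (λ z → + 16 ℤ.* (s ℤ.* G (+ j ℤ.+ t)) ℤ.- + 4 ℤ.* (x ℤ.* s ℤ.* G z))
           (ℤ.suc-+ j t) ⟨
    + 16 ℤ.* scaled j ℤ.- + 4 ℤ.* scaled (suc j)  ∎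
    where
    x = ℤ.- + 4
    s = x ℤ.^ j
    identity : ∀ s a b → -[1+ 3 ] ℤ.* (-[1+ 3 ] ℤ.* s) ℤ.* (a ℤ.+ b)
      ≡ + 16 ℤ.* (s ℤ.* b) ℤ.- + 4 ℤ.* (-[1+ 3 ] ℤ.* s ℤ.* a)
    identity = solve-∀

  scaled-0 : scaled 0 ≡ G t
  scaled-0 = trans (ℤ.*-identityˡ (G (0ℤ ℤ.+ t))) (cong G (ℤ.+-identityˡ t))

  scaled-1 : scaled 1 ≡ -[1+ 3 ] ℤ.* G (t ℤ.+ 1ℤ)
  scaled-1 = cong (λ z → -[1+ 3 ] ℤ.* G z) (ℤ.+-comm 1ℤ t)

  module _ (n : ℕ) where
    u v : ℤ
    u = + fib (3 ℕ.* n)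
    v = + lucas (3 ℕ.* n)

    -- Replacing `parity n` by a variable lets `oddValue` compute once the parity is known.
    oddSum-value : ∀ {p} → parity n ≡ p →
      + 8 ℤ.* oddSum scaled n ≡ oddValue p (G t) (-[1+ 3 ] ℤ.* G (t ℤ.+ 1ℤ)) u v
    oddSum-value refl = trans (proj₁ (closedForms n scaled scaled-recurrent))
      (cong₂ (λ a b → oddValue (parity n) a b u v) scaled-0 scaled-1)

    oddSum-odd : parity n ≡ 1ℙ → oddSum scaled n ≡ ℤ.- (G (t ℤ.+ 1ℤ) ℤ.* v)
    oddSum-odd odd = ℤ.*-cancelˡ-≡ (+ 8) _ _
      (trans (oddSum-value odd) (identity (G (t ℤ.+ 1ℤ)) v))
      where
      identity : ∀ b v → + 2 ℤ.* (-[1+ 3 ] ℤ.* b ℤ.* v) ≡ + 8 ℤ.* (ℤ.- (b ℤ.* v))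
      identity = solve-∀

    -- With a = G(t) and b = -4 G(t+1), 8a - b = 4 (2 G(t) + G(t+1)), and the bracket is 2 G(t+2) -
    -- G(t+1) = H(t+1).
    oddSum-even : ∀ {H} → Companion G H → parity n ≡ 0ℙ →
      oddSum scaled n ≡ H (t ℤ.+ 1ℤ) ℤ.* u
    oddSum-even {H} companion even = ℤ.*-cancelˡ-≡ (+ 8) _ _ (begin
      + 8 ℤ.* oddSum scaled n
        ≡⟨ oddSum-value even ⟩
      + 2 ℤ.* ((+ 8 ℤ.* G t ℤ.- -[1+ 3 ] ℤ.* G (t ℤ.+ 1ℤ)) ℤ.* u)
        ≡⟨ cong (λ z → + 2 ℤ.* ((+ 8 ℤ.* G t ℤ.- -[1+ 3 ] ℤ.* G z) ℤ.* u)) (ℤ.+-comm t 1ℤ) ⟩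
      + 2 ℤ.* ((+ 8 ℤ.* G t ℤ.- -[1+ 3 ] ℤ.* G (ℤ.suc t)) ℤ.* u)
        ≡⟨ identity (G t) (G (ℤ.suc t)) u ⟩
      + 8 ℤ.* ((+ 2 ℤ.* (G (ℤ.suc t) ℤ.+ G t) ℤ.- G (ℤ.suc t)) ℤ.* u)
        ≡⟨ cong (λ x → + 8 ℤ.* ((+ 2 ℤ.* x ℤ.- G (ℤ.suc t)) ℤ.* u)) (G-additive t) ⟨
      + 8 ℤ.* ((+ 2 ℤ.* G (ℤ.suc (ℤ.suc t)) ℤ.- G (ℤ.suc t)) ℤ.* u)
        ≡⟨ cong (λ x → + 8 ℤ.* (x ℤ.* u)) (companion (ℤ.suc t)) ⟨
      + 8 ℤ.* (H (ℤ.suc t) ℤ.* u)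
        ≡⟨ cong (λ z → + 8 ℤ.* (H z ℤ.* u)) (ℤ.+-comm 1ℤ t) ⟩
      + 8 ℤ.* (H (t ℤ.+ 1ℤ) ℤ.* u)  ∎)
      where
      identity : ∀ a b u → + 2 ℤ.* ((+ 8 ℤ.* a ℤ.- -[1+ 3 ] ℤ.* b) ℤ.* u)
        ≡ + 8 ℤ.* ((+ 2 ℤ.* (b ℤ.+ a) ℤ.- b) ℤ.* u)
      identity = solve-∀

-- Passage to the rationals

-- `fromℤ a` is `fromℚᵘ (mkℚᵘ a 0)` by computation, so identities between rationals can be moved to
-- unnormalised fractions and proved there by cross-multiplication.
fromℚᵘ-homo-* : ∀ p q → fromℚᵘ (p ℚᵘ.* q) ≡ fromℚᵘ p * fromℚᵘ q
fromℚᵘ-homo-* p q = ℚ.toℚᵘ-injective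
  (ℚᵘ.≃-trans (ℚ.toℚᵘ-fromℚᵘ (p ℚᵘ.* q))
  (ℚᵘ.≃-trans (ℚᵘ.*-cong (ℚᵘ.≃-sym (ℚ.toℚᵘ-fromℚᵘ p)) (ℚᵘ.≃-sym (ℚ.toℚᵘ-fromℚᵘ q)))
  (ℚᵘ.≃-sym (ℚ.toℚᵘ-homo-* (fromℚᵘ p) (fromℚᵘ q)))))

fromℚᵘ-homo-+ : ∀ p q → fromℚᵘ (p ℚᵘ.+ q) ≡ fromℚᵘ p + fromℚᵘ q
fromℚᵘ-homo-+ p q = ℚ.toℚᵘ-injective
  (ℚᵘ.≃-trans (ℚ.toℚᵘ-fromℚᵘ (p ℚᵘ.+ q))
  (ℚᵘ.≃-trans (ℚᵘ.+-cong (ℚᵘ.≃-sym (ℚ.toℚᵘ-fromℚᵘ p)) (ℚᵘ.≃-sym (ℚ.toℚᵘ-fromℚᵘ q)))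
  (ℚᵘ.≃-sym (ℚ.toℚᵘ-homo-+ (fromℚᵘ p) (fromℚᵘ q)))))

fromℤ-homo-* : ∀ a b → fromℤ (a ℤ.* b) ≡ fromℤ a * fromℤ b
fromℤ-homo-* a b = fromℚᵘ-homo-* (mkℚᵘ a 0) (mkℚᵘ b 0)

fromℤ-homo-+ : ∀ a b → fromℤ (a ℤ.+ b) ≡ fromℤ a + fromℤ b
fromℤ-homo-+ a b = trans
  -- The unnormalised sum of two fractions over 1 has numerator a·1 + b·1.
  (cong fromℤ (sym (cong₂ ℤ._+_ (ℤ.*-identityʳ a) (ℤ.*-identityʳ b))))
  (fromℚᵘ-homo-+ (mkℚᵘ a 0) (mkℚᵘ b 0))

½-fromℤ-neg : ∀ a b → ½ * fromℤ (ℤ.- (a ℤ.* b)) ≡ -½ * fromℤ a * fromℤ b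
½-fromℤ-neg a b = begin
  ½ * fromℤ (ℤ.- (a ℤ.* b))
    ≡⟨ cong (λ x → ½ * fromℤ x) (ℤ.-1*i≡-i (a ℤ.* b)) ⟨
  ½ * fromℤ (-1ℤ ℤ.* (a ℤ.* b))
    ≡⟨ cong (½ *_) (fromℤ-homo-* -1ℤ (a ℤ.* b)) ⟩
  ½ * (fromℤ -1ℤ * fromℤ (a ℤ.* b))
    -- `½ * fromℤ -1ℤ` computes to `-½`.
    ≡⟨ ℚ.*-assoc ½ (fromℤ -1ℤ) (fromℤ (a ℤ.* b)) ⟨
  -½ * fromℤ (a ℤ.* b)
    ≡⟨ cong (-½ *_) (fromℤ-homo-* a b) ⟩
  -½ * (fromℤ a * fromℤ b)
    ≡⟨ ℚ.*-assoc -½ (fromℤ a) (fromℤ b) ⟨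
  -½ * fromℤ a * fromℤ b  ∎

½-fromℤ-scale : ∀ c a b → ½ * fromℤ (c ℤ.* a ℤ.* b) ≡ ½ * fromℤ c * fromℤ a * fromℤ b
½-fromℤ-scale c a b = begin
  ½ * fromℤ (c ℤ.* a ℤ.* b)
    ≡⟨ cong (½ *_) (trans (fromℤ-homo-* (c ℤ.* a) b) (cong (_* fromℤ b) (fromℤ-homo-* c a))) ⟩
  ½ * (fromℤ c * fromℤ a * fromℤ b)
    ≡⟨ ℚ.*-assoc ½ (fromℤ c * fromℤ a) (fromℤ b) ⟨
  ½ * (fromℤ c * fromℤ a) * fromℤ b
    ≡⟨ cong (_* fromℤ b) (ℚ.*-assoc ½ (fromℤ c) (fromℤ a)) ⟨
  ½ * fromℤ c * fromℤ a * fromℤ b  ∎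

-- k/(n+k) C(n+k, 2k) = ½ C(n+k-1, 2k-1), for n = j + 1 + d and k = j + 1, with
-- denominators cleared.
weight-binomial : ∀ j d → let n = suc j ℕ.+ d in
  2 ℕ.* (suc j ℕ.* ((n ℕ.+ suc j) C (n ℕ.∸ suc j)))
    ≡ (n ℕ.+ suc j) ℕ.* ((n ℕ.+ j) C suc (j ℕ.+ j))
weight-binomial j d = begin
  2 ℕ.* (suc j ℕ.* ((n ℕ.+ suc j) C (n ℕ.∸ suc j)))
    ≡⟨ cong (λ c → 2 ℕ.* (suc j ℕ.* c)) sym-C ⟩
  2 ℕ.* (suc j ℕ.* (suc (n ℕ.+ j) C suc (suc (j ℕ.+ j))))
    ≡⟨ double j (suc (n ℕ.+ j) C suc (suc (j ℕ.+ j))) ⟩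
  suc (suc (j ℕ.+ j)) ℕ.* (suc (n ℕ.+ j) C suc (suc (j ℕ.+ j)))
    ≡⟨ [1+k]*[1+n]C[1+k]≡[1+n]*nCk (n ℕ.+ j) (suc (j ℕ.+ j)) ⟩
  suc (n ℕ.+ j) ℕ.* ((n ℕ.+ j) C suc (j ℕ.+ j))
    ≡⟨ cong (ℕ._* ((n ℕ.+ j) C suc (j ℕ.+ j))) (ℕ.+-suc n j) ⟨
  (n ℕ.+ suc j) ℕ.* ((n ℕ.+ j) C suc (j ℕ.+ j))  ∎
  where
  n = suc j ℕ.+ d
  double : ∀ j c → 2 ℕ.* (suc j ℕ.* c) ≡ suc (suc (j ℕ.+ j)) ℕ.* c
  double = ℕ-Ring.solve-∀
  total : suc (n ℕ.+ j) ≡ suc (suc (j ℕ.+ j)) ℕ.+ d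
  total = lemma j d
    where
    lemma : ∀ j d → suc (suc (j ℕ.+ d ℕ.+ j)) ≡ suc (suc (j ℕ.+ j ℕ.+ d))
    lemma = ℕ-Ring.solve-∀
  sym-C : (n ℕ.+ suc j) C (n ℕ.∸ suc j) ≡ suc (n ℕ.+ j) C suc (suc (j ℕ.+ j))
  sym-C = begin
    (n ℕ.+ suc j) C (n ℕ.∸ suc j)
      ≡⟨ cong₂ _C_ (ℕ.+-suc n j) (ℕ.m+n∸m≡n j d) ⟩
    suc (n ℕ.+ j) C d
      ≡⟨ cong (suc (n ℕ.+ j) C_)
           (trans (cong (ℕ._∸ suc (suc (j ℕ.+ j))) total) (ℕ.m+n∸m≡n (suc (suc (j ℕ.+ j))) d)) ⟨
    suc (n ℕ.+ j) C (suc (n ℕ.+ j) ℕ.∸ suc (suc (j ℕ.+ j)))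
      ≡⟨ nCk≡nC[n∸k] (subst (suc (suc (j ℕ.+ j)) ≤_) (sym total) (ℕ.m≤m+n _ d)) ⟨
    suc (n ℕ.+ j) C suc (suc (j ℕ.+ j))  ∎

-- Writing n as `suc j + d` makes the truncated subtraction exact and exposes n + k as a successor.
-- The equation then becomes `weight-binomial` after cross-multiplication.
weight-halved : ∀ n j g → suc j ≤ n →
  weight n (suc j) * fromℤ g
    ≡ ½ * fromℤ (+ ((n ℕ.+ j) C suc (j ℕ.+ j)) ℤ.* ((ℤ.- + 4) ℤ.^ suc j ℤ.* g))
weight-halved n j g j<n = subst Halved (ℕ.m+[n∸m]≡n j<n) (halved (n ℕ.∸ suc j))
  where
  s = (ℤ.- + 4) ℤ.^ suc j
  Halved : ℕ → Set
  Halved n = weight n (suc j) * fromℤ g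
    ≡ ½ * fromℤ (+ ((n ℕ.+ j) C suc (j ℕ.+ j)) ℤ.* (s ℤ.* g))
  halved : ∀ d → Halved (suc j ℕ.+ d)
  halved d = begin
    fromℚᵘ s′ * fromℚᵘ q * fromℚᵘ c′ * fromℚᵘ g′
      ≡⟨ cong (λ x → x * fromℚᵘ c′ * fromℚᵘ g′) (fromℚᵘ-homo-* s′ q) ⟨
    fromℚᵘ (s′ ℚᵘ.* q) * fromℚᵘ c′ * fromℚᵘ g′
      ≡⟨ cong (_* fromℚᵘ g′) (fromℚᵘ-homo-* (s′ ℚᵘ.* q) c′) ⟨
    fromℚᵘ (s′ ℚᵘ.* q ℚᵘ.* c′) * fromℚᵘ g′
      ≡⟨ fromℚᵘ-homo-* (s′ ℚᵘ.* q ℚᵘ.* c′) g′ ⟨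
    fromℚᵘ (s′ ℚᵘ.* q ℚᵘ.* c′ ℚᵘ.* g′)
      ≡⟨ ℚ.fromℚᵘ-cong {s′ ℚᵘ.* q ℚᵘ.* c′ ℚᵘ.* g′} {mkℚᵘ 1ℤ 1 ℚᵘ.* r} (*≡* cross) ⟩
    fromℚᵘ (mkℚᵘ 1ℤ 1 ℚᵘ.* r)
      ≡⟨ fromℚᵘ-homo-* (mkℚᵘ 1ℤ 1) r ⟩
    ½ * fromℤ (+ b ℤ.* (s ℤ.* g))  ∎
    where
    -- `mkℚᵘ` takes the denominator minus one; here k = j + 1 and n + k = `suc n+k-1`.
    n+k-1 = j ℕ.+ d ℕ.+ suc j
    b = (suc j ℕ.+ d ℕ.+ j) C suc (j ℕ.+ j)
    c = (suc j ℕ.+ d ℕ.+ suc j) C (suc j ℕ.+ d ℕ.∸ suc j)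
    s′ q c′ g′ r : ℚᵘ
    s′ = mkℚᵘ s 0
    q  = mkℚᵘ (+ suc j) n+k-1
    c′ = mkℚᵘ (+ c) 0
    g′ = mkℚᵘ g 0
    r  = mkℚᵘ (+ b ℤ.* (s ℤ.* g)) 0
    core : + 2 ℤ.* (+ suc j ℤ.* + c) ≡ + suc n+k-1 ℤ.* + b
    core = begin
      + 2 ℤ.* (+ suc j ℤ.* + c)   ≡⟨ cong (+ 2 ℤ.*_) (ℤ.pos-* (suc j) c) ⟨
      + 2 ℤ.* + (suc j ℕ.* c)     ≡⟨ ℤ.pos-* 2 (suc j ℕ.* c) ⟨
      + (2 ℕ.* (suc j ℕ.* c))     ≡⟨ cong +_ (weight-binomial j d) ⟩
      + (suc n+k-1 ℕ.* b)         ≡⟨ ℤ.pos-* (suc n+k-1) b ⟩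
      + suc n+k-1 ℤ.* + b         ∎
    shuffle₁ : ∀ s k c g → s ℤ.* k ℤ.* c ℤ.* g ℤ.* + 2 ≡ s ℤ.* g ℤ.* (+ 2 ℤ.* (k ℤ.* c))
    shuffle₁ = solve-∀
    shuffle₂ : ∀ s b g m → s ℤ.* g ℤ.* (m ℤ.* b) ≡ 1ℤ ℤ.* (b ℤ.* (s ℤ.* g)) ℤ.* m
    shuffle₂ = solve-∀
    cross : ℚᵘ.↥ (s′ ℚᵘ.* q ℚᵘ.* c′ ℚᵘ.* g′) ℤ.* ℚᵘ.↧ (mkℚᵘ 1ℤ 1 ℚᵘ.* r)
          ≡ ℚᵘ.↥ (mkℚᵘ 1ℤ 1 ℚᵘ.* r) ℤ.* ℚᵘ.↧ (s′ ℚᵘ.* q ℚᵘ.* c′ ℚᵘ.* g′)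
    cross = begin
      s ℤ.* + suc j ℤ.* + c ℤ.* g ℤ.* + 2
        ≡⟨ shuffle₁ s (+ suc j) (+ c) g ⟩
      s ℤ.* g ℤ.* (+ 2 ℤ.* (+ suc j ℤ.* + c))
        ≡⟨ cong (s ℤ.* g ℤ.*_) core ⟩
      s ℤ.* g ℤ.* (+ suc n+k-1 ℤ.* + b)
        ≡⟨ shuffle₂ s (+ b) g (+ suc n+k-1) ⟩
      1ℤ ℤ.* (+ b ℤ.* (s ℤ.* g)) ℤ.* + suc n+k-1
        ≡⟨ cong (λ m → 1ℤ ℤ.* (+ b ℤ.* (s ℤ.* g)) ℤ.* + m) denominator ⟨
      ℚᵘ.↥ (mkℚᵘ 1ℤ 1 ℚᵘ.* r) ℤ.* ℚᵘ.↧ (s′ ℚᵘ.* q ℚᵘ.* c′ ℚᵘ.* g′)  ∎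
      where
      denominator : 1 ℕ.* suc n+k-1 ℕ.* 1 ℕ.* 1 ≡ suc n+k-1
      denominator = lemma (suc n+k-1)
        where
        lemma : ∀ m → 1 ℕ.* m ℕ.* 1 ℕ.* 1 ≡ m
        lemma = ℕ-Ring.solve-∀

-- Reindexes by k = j + 1. Terms are compared only for k ≤ m, the range in which `weight-halved`
-- applies when m = n.
sumFrom1-halved : ∀ (w : (k : ℕ) → .{{NonZero k}} → ℚ) f m →
  (∀ j → suc j ≤ m → w (suc j) ≡ ½ * fromℤ (f j)) →
  sumFrom1 m (λ k → w k) ≡ ½ * fromℤ (sum< m f)
sumFrom1-halved w f zero    _    = refl
sumFrom1-halved w f (suc m) term = begin
  sumFrom1 m (λ k → w k) + w (suc m)
    ≡⟨ cong₂ _+_ (sumFrom1-halved w f m (λ j j<m → term j (ℕ.m≤n⇒m≤1+n j<m))) (term m ℕ.≤-refl) ⟩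
  ½ * fromℤ (sum< m f) + ½ * fromℤ (f m)
    ≡⟨ ℚ.*-distribˡ-+ ½ (fromℤ (sum< m f)) (fromℤ (f m)) ⟨
  ½ * (fromℤ (sum< m f) + fromℤ (f m))
    ≡⟨ cong (½ *_) (fromℤ-homo-+ (sum< m f) (f m)) ⟨
  ½ * fromℤ (sum< (suc m) f)  ∎

-- Assembly of the four cases

weightedSum-halved : ∀ G (G-additive : Additive G) n t →
  (∑[1≤ k ≤ n ] (weight n k * fromℤ (G ((+ k) ℤ.+ t))))
    ≡ ½ * fromℤ (oddSum (scaled G G-additive t) n)
weightedSum-halved G G-additive n t = sumFrom1-halved _ _ n
  (λ j j<n → weight-halved n j (G (+ suc j ℤ.+ t)) j<n)

theorem18 : (n : ℕ) (t : ℤ) →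
    ( (parity n ≡ 1ℙ →
    (∑[1≤ k ≤ n ] (weight n k * fromℤ (L ((+ k) ℤ.+ t))))
    ≡ -½ * fromℤ (L (t ℤ.+ 1ℤ)) * fromℤ (L (+ (3 ℕ.* n))))
    × (parity n ≡ 0ℙ →
    (∑[1≤ k ≤ n ] (weight n k * fromℤ (L ((+ k) ℤ.+ t))))
    ≡ ((+ 5) / 2) * fromℤ (F (t ℤ.+ 1ℤ)) * fromℤ (F (+ (3 ℕ.* n)))))
    ×
    ( (parity n ≡ 1ℙ →
    (∑[1≤ k ≤ n ] (weight n k * fromℤ (F ((+ k) ℤ.+ t))))
    ≡ -½ * fromℤ (F (t ℤ.+ 1ℤ)) * fromℤ (L (+ (3 ℕ.* n))))
    × (parity n ≡ 0ℙ →
    (∑[1≤ k ≤ n ] (weight n k * fromℤ (F ((+ k) ℤ.+ t))))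
    ≡ ½ * fromℤ (L (t ℤ.+ 1ℤ)) * fromℤ (F (+ (3 ℕ.* n)))))
theorem18 n t =
    ( (λ odd → trans (weightedSum-halved L L-additive n t)
        (trans (cong (λ x → ½ * fromℤ x) (oddSum-odd L L-additive t n odd))
          (½-fromℤ-neg (L (t ℤ.+ 1ℤ)) (+ lucas (3 ℕ.* n)))))
    , (λ even → trans (weightedSum-halved L L-additive n t)
        -- The companion of L is 5F, and `½ * fromℤ (+ 5)` computes to 5/2.
        (trans (cong (λ x → ½ * fromℤ x) (oddSum-even L L-additive t n L-companion even))
          (½-fromℤ-scale (+ 5) (F (t ℤ.+ 1ℤ)) (+ fib (3 ℕ.* n))))))
  , ( (λ odd → trans (weightedSum-halved F F-additive n t)
        (trans (cong (λ x → ½ * fromℤ x) (oddSum-odd F F-additive t n odd))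
          (½-fromℤ-neg (F (t ℤ.+ 1ℤ)) (+ lucas (3 ℕ.* n)))))
    , (λ even → trans (weightedSum-halved F F-additive n t)
        (trans (cong (λ x → ½ * fromℤ x) (oddSum-even F F-additive t n F-companion even))
          (trans (cong (½ *_) (fromℤ-homo-* (L (t ℤ.+ 1ℤ)) (+ fib (3 ℕ.* n))))
            (sym (ℚ.*-assoc ½ (fromℤ (L (t ℤ.+ 1ℤ))) (fromℤ (+ fib (3 ℕ.* n)))))))))
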